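{- For every $n\ge 1$ let $H_n$ and $P_n$ denote the numbers of tilings of the regions $H_n$ and $P_n$ (defined in the context). Then $H_1=1$, $H_2=3$, $P_1=1$, $P_2=2$, and for all $n\ge 2$ $$H_n=H_{n-1}+2P_{n-1},\qquad P_n=H_{n-1}+P_{n-1}.$$ Consequently, for all $n\ge 3$, $H_n=2H_{n-1}+H_{n-2}$ and $P_n=2P_{n-1}+P_{n-2}$. In particular $(P_n)_{n\ge1}=(1,2,5,12,29,70,\dots)$ is the sequence of Pell numbers and $(H_n)_{n\ge1}=(1,3,7,17,41,99,\dots)$, i.e. for all $n\ge1$ $$P_n=\frac{(1+\sqrt2)^n-(1-\sqrt2)^n}{2\sqrt2},\qquad H_n=\frac{(1+\sqrt2)^n+(1-\sqrt2)^n}{2}.$$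
   Context: Let $s=\sqrt3/2$. Consider the standard triangular lattice in the plane whose vertices are the points $(a+b/2,\,bs)$ with $a,b\in\mathbb Z$ and whose edges are the unit segments joining lattice points in the directions $0^\circ,60^\circ,120^\circ$; it divides the plane into unit equilateral triangles called cells. A small tile is a single cell; a large tile is an equilateral triangle of side $2$ whose vertices are lattice points (so it is a union of $4$ cells; it may point up or down). For a region $R$ that is a finite union of cells, a tiling of $R$ is a finite set of small and large tiles, each contained in $R$, with pairwise disjoint interiors and union equal to $R$. For $n\ge1$, the region $H_n$ is the union of the trapezoid with vertices $(0,0),(n,0),(n-\tfrac12,s),(\tfrac12,s)$ and the trapezoid with vertices $(\tfrac12,s),(n-\tfrac12,s),(n,2s),(0,2s)$ (for $n=1$ these degenerate to two unit triangles meeting at a single point); $H_n$ consists of $4n-2$ cells. The region $P_n$ is $H_n$ with the cell with vertices $(n-1,0),(n,0),(n-\tfrac12,s)$ removed ($4n-3$ cells). By abuse of notation, $H_n$ and $P_n$ also denote the number of tilings of these regions. -}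

module Defs where

open import Level using (Level; 0ℓ; _⊔_)
open import Algebra.Apartness.Bundles using (HeytingField; HeytingCommutativeRing)
open import Algebra.Bundles using (CommutativeRing)
import Algebra.Properties.Semiring.Exp as Exp
import Algebra.Properties.Semiring.Mult as Mult
open import Data.Fin.Base using (Fin)
open import Data.Integer.Base using (ℤ; +_; 0ℤ; 1ℤ; _≤_; _+_; _-_)
open import Data.List.Base using (List; []; _∷_)
open import Data.List.Membership.Propositional using (_∈_)
open import Data.List.Relation.Binary.BagAndSetEquality using ([_]-Equality; set)
open import Data.List.Relation.Binary.Disjoint.Propositional using (Disjoint)
open import Data.List.Relation.Unary.All using (All)
open import Data.List.Relation.Unary.Any using (Any)
open import Data.Nat.Base as ℕ using (ℕ; zero; suc)
open import Data.Product.Base using (_×_; _,_; proj₁)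
open import Function.Bundles using (Inverse)
open import Relation.Binary.Bundles using (Setoid)
import Relation.Binary.Construct.On as On
open import Relation.Binary.PropositionalEquality as ≡ using (_≡_; _≢_)
open import Relation.Unary using (Pred; _∪_)

-- The pair (a , b) stands for the lattice point (a + b/2 , b·√3/2) of the
-- plane.  In these oblique coordinates the lattice lines are x = const,
-- y = const and x + y = const.
Point : Set
Point = ℤ × ℤ

data Cell : Set where
  up down : ℤ → ℤ → Cell

corners : Cell → List Point
corners (up   a b) = (a , b) ∷ (a + 1ℤ , b) ∷ (a , b + 1ℤ) ∷ []
corners (down a b) = (a + 1ℤ , b) ∷ (a , b + 1ℤ) ∷ (a + 1ℤ , b + 1ℤ) ∷ []

-- large-up a b   is the triangle (a , b), (a + 2 , b), (a , b + 2);
-- large-down a b is the triangle (a + 2 , b), (a , b + 2), (a + 2 , b + 2).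
data Tile : Set where
  small               : Cell → Tile
  large-up large-down : ℤ → ℤ → Tile

cells : Tile → List Cell
cells (small c)        = c ∷ []
cells (large-up   a b) = up a b ∷ up (a + 1ℤ) b ∷ up a (b + 1ℤ) ∷ down a b ∷ []
cells (large-down a b) = down (a + 1ℤ) b ∷ down a (b + 1ℤ) ∷ down (a + 1ℤ) (b + 1ℤ)
                       ∷ up (a + 1ℤ) (b + 1ℤ) ∷ []

-- A union of cells is given by the cells it consists of.
Region : Set₁
Region = Pred Cell 0ℓ

-- The cells contained in a convex set, the latter given by the lattice points
-- it contains.
cellsWithin : Pred Point 0ℓ → Region
cellsWithin S c = All S (corners c)

-- In the plane: the trapezoid (0,0), (n,0), (n-½,s), (½,s), with s = √3/2,
-- whose vertices have oblique coordinates (0,0), (n,0), (n-1,1), (0,1).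
lowerTrapezoid : ℕ → Pred Point 0ℓ
lowerTrapezoid n (x , y) = 0ℤ ≤ y × y ≤ 1ℤ × 0ℤ ≤ x × x + y ≤ + n

-- In the plane: the trapezoid (½,s), (n-½,s), (n,2s), (0,2s), whose vertices
-- have oblique coordinates (0,1), (n-1,1), (n-1,2), (-1,2).
upperTrapezoid : ℕ → Pred Point 0ℓ
upperTrapezoid n (x , y) = 1ℤ ≤ y × y ≤ + 2 × 1ℤ ≤ x + y × x ≤ + n - 1ℤ

regionH : ℕ → Region
regionH n = cellsWithin (lowerTrapezoid n) ∪ cellsWithin (upperTrapezoid n)

regionP : ℕ → Region
regionP n c = regionH n c × c ≢ up (+ n - 1ℤ) 0ℤ

-- Unions of cells have disjoint interiors iff they have no cell in common.
record Tiling (R : Region) : Set where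
  field
    tiles     : List Tile
    contained : ∀ {t c} → t ∈ tiles → c ∈ cells t → R c
    disjoint  : ∀ {t u} → t ∈ tiles → u ∈ tiles → t ≢ u → Disjoint (cells t) (cells u)
    covering  : ∀ {c} → R c → Any (λ t → c ∈ cells t) tiles

-- A tiling is a finite set of tiles, so lists of tiles are compared up to
-- having the same elements: order and repetitions are irrelevant.
tilings : Region → Setoid 0ℓ 0ℓ
tilings R = record
  { Carrier       = Tiling R
  ; _≈_           = λ T U → tiles T ≈ˢ tiles U
  ; isEquivalence = On.isEquivalence tiles isEquivalence
  }
  where
  open Tiling
  open Setoid ([ set ]-Equality Tile) renaming (_≈_ to _≈ˢ_)

HasTilingCount : Region → ℕ → Set
HasTilingCount R k = Inverse (tilings R) (≡.setoid (Fin k))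

pell : ℕ → ℕ
pell zero          = 0
pell (suc zero)    = 1
pell (suc (suc n)) = 2 ℕ.* pell (suc n) ℕ.+ pell n

-- The closed forms, for a square root r of 2 in a field K such as ℝ.
module _ {c ℓ₁ ℓ₂} (K : HeytingField c ℓ₁ ℓ₂) where

  private
    module K where
      open HeytingField K public
      open CommutativeRing
        (HeytingCommutativeRing.commutativeRing heytingCommutativeRing) public
        using (semiring)
      open Exp semiring public using (_^_)
      open Mult semiring public using () renaming (_×_ to _·_)

      fromℕ : ℕ → Carrier
      fromℕ n = n · 1#

      -- #⇒invertible gives an inverse of y - 0#.
      divide : (x y : Carrier) → y # 0# → Carrier
      divide x y y#0 = x * proj₁ (#⇒invertible y#0)

  ClosedForms : (H P : ℕ → ℕ) → Set (c ⊔ ℓ₁ ⊔ ℓ₂)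
  ClosedForms H P =
    (r : Carrier) → r * r ≈ fromℕ 2 →
    (2#0 : fromℕ 2 # 0#) (2r#0 : fromℕ 2 * r # 0#) →
    ∀ n → 1 ℕ.≤ n →
      fromℕ (P n) ≈ divide ((1# K.+ r) ^ n K.- (1# K.- r) ^ n) (fromℕ 2 * r) 2r#0
    × fromℕ (H n) ≈ divide ((1# K.+ r) ^ n K.+ (1# K.- r) ^ n) (fromℕ 2) 2#0
    where open K hiding (_+_; _-_)

{-# OPTIONS --safe #-}
module Submission where

open import Defs
open import Algebra.Apartness.Bundles using (HeytingField; HeytingCommutativeRing)
open import Algebra.Bundles using (CommutativeRing; module AbelianGroup)
import Algebra.Properties.Group as GroupProperties
import Algebra.Properties.Ring as RingProperties
import Algebra.Properties.Semiring.Exp as Exp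
import Algebra.Properties.Semiring.Mult as Mult
open import Data.Empty using (⊥-elim-irr)
open import Data.Fin.Base using (Fin; zero)
open import Data.Fin.Properties using (+↔⊎)
open import Data.Integer.Base as ℤ using (ℤ; +_; 0ℤ; 1ℤ; _⊖_; +≤+; -≤+; -≤-)
import Data.Integer.Properties as ℤ
open import Data.List.Base using (List; []; _∷_; _++_; map; filter; upTo; cartesianProductWith)
import Data.List.Membership.DecPropositional as DecMembership
open import Data.List.Membership.Propositional using (_∈_; _∉_; find; lose)
open import Data.List.Membership.Propositional.Properties
open import Data.List.Relation.Binary.Disjoint.Propositional using (Disjoint)
open import Data.List.Relation.Binary.Subset.Propositional using (_⊆_)
open import Data.List.Relation.Unary.All using ([]; _∷_)
open import Data.List.Relation.Unary.Any as Any using (Any; here; there)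
open import Data.Maybe.Base using (Maybe; just; nothing)
open import Data.Maybe.Properties using (just-injective)
open import Data.Nat.Base using (ℕ; zero; suc; _+_; _*_; _∸_; _≤_; _<_; z≤n; s≤s; s≤s⁻¹)
import Data.Nat.Properties as ℕ
open import Data.Nat.Tactic.RingSolver using (solve-∀)
open import Data.Product.Base using (Σ-syntax; ∃; ∃₂; _×_; _,_; proj₁; proj₂; uncurry)
open import Data.Sum.Base using (_⊎_; inj₁; inj₂)
open import Data.Sum.Function.Propositional using (_⊎-↔_)
open import Function.Base using (_∘_; case_of_)
open import Function.Bundles using (_⇔_; mk⇔; Equivalence; Inverse; _↔_; mk↔ₛ′)
open import Function.Construct.Composition using (inverse; _↔-∘_)
open import Function.Construct.Symmetry using (↔-sym)
open import Level using (Level)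
open import Relation.Binary.Definitions using (DecidableEquality)
open import Relation.Binary.PropositionalEquality
import Relation.Binary.Reasoning.Setoid as SetoidReasoning
open import Relation.Nullary using (¬_; Dec; yes; no; contradiction; ¬?)
open import Relation.Nullary.Decidable using (map′; _×-dec_; decidable-stable)

-- A tiling is determined by its large tiles.  With m = n − 1, the strip H_n has
-- m positions for a large tile, at each of which it may point up (△) or down
-- (▽).  Two large tiles overlap iff they have the same position, or the same
-- direction and adjacent positions.  So tilings of H_n are the words of length
-- m over {△, ▽, blank} in which neither △△ nor ▽▽ occurs, and those of P_n the
-- words not ending in △; deleting the last letter gives the recurrences.

-- Coordinates of cells and large tiles in the strip.

module ℤ-Group = GroupProperties (AbelianGroup.group ℤ.+-0-abelianGroup)

data Side : Set where
  △ ▽ : Side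

-- Indexed so that the large tile k at position a consists of outer k a,
-- outer k (a + 1) and both inner cells at a; only ▽ needs a shift, by
-- a ⊖ 1 = a − 1 in ℤ.
outer inner : Side → ℕ → Cell
outer △ a = up (+ a) 0ℤ
outer ▽ a = down (a ⊖ 1) 1ℤ
inner △ a = up (+ a) 1ℤ
inner ▽ a = down (+ a) 0ℤ

tile : Side → ℕ → Tile
tile △ a = large-up (+ a) 0ℤ
tile ▽ a = large-down (a ⊖ 1) 0ℤ

⊖1+1 : ∀ a → a ⊖ 1 ℤ.+ 1ℤ ≡ + a
⊖1+1 zero    = refl
⊖1+1 (suc a) = cong +_ (ℕ.+-comm a 1)

+1≡suc : ∀ a → + a ℤ.+ 1ℤ ≡ + suc a
+1≡suc a = cong +_ (ℕ.+-comm a 1)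

outer-injective : ∀ {k j a b} → outer k a ≡ outer j b → k ≡ j × a ≡ b
outer-injective {△} {△} refl = refl , refl
-- Matching on both positions lets `a ⊖ 1` compute; the mixed cases would equate -1 with a natural
-- number.
outer-injective {▽} {▽} {zero}  {zero}  eq = refl , refl
outer-injective {▽} {▽} {suc a} {suc b} refl = refl , refl

inner-injective : ∀ {k j a b} → inner k a ≡ inner j b → k ≡ j × a ≡ b
inner-injective {△} {△} refl = refl , refl
inner-injective {▽} {▽} refl = refl , refl

outer≢inner : ∀ {k j a b} → outer k a ≢ inner j b
outer≢inner {△} {△} ()
outer≢inner {▽} {▽} ()

tile-injective : ∀ {k j a b} → tile k a ≡ tile j b → k ≡ j × a ≡ b
tile-injective {△} {△} refl = refl , refl
tile-injective {▽} {▽} {zero}  {zero}  eq = refl , refl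
tile-injective {▽} {▽} {suc a} {suc b} refl = refl , refl

tile≢small : ∀ {k a c} → tile k a ≢ small c
tile≢small {△} ()
tile≢small {▽} ()

_≟ˢ_ : DecidableEquality Side
△ ≟ˢ △ = yes refl
△ ≟ˢ ▽ = no λ ()
▽ ≟ˢ △ = no λ ()
▽ ≟ˢ ▽ = yes refl

-- Abstracts from the list order in `cells` and from the shift of ▽, so that later arguments treat
-- both directions at once.
data InTile (k : Side) (a : ℕ) : Cell → Set where
  left   : InTile k a (outer k a)
  right  : InTile k a (outer k (suc a))
  centre : ∀ j → InTile k a (inner j a)

∈-tile⁻ : ∀ k {a c} → c ∈ cells (tile k a) → InTile k a c
∈-tile⁻ △ (here refl) = left
∈-tile⁻ △ {a} (there (here refl)) rewrite +1≡suc a = right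
∈-tile⁻ △ (there (there (here refl))) = centre △
∈-tile⁻ △ (there (there (there (here refl)))) = centre ▽
∈-tile⁻ ▽ {a} c∈ rewrite ⊖1+1 a with c∈
... | here refl = centre ▽
... | there (here refl) = left
... | there (there (here refl)) = right
... | there (there (there (here refl))) = centre △

∈-tile⁺ : ∀ {k a c} → InTile k a c → c ∈ cells (tile k a)
∈-tile⁺ {△} left = here refl
∈-tile⁺ {△} {a} right rewrite +1≡suc a = there (here refl)
∈-tile⁺ {△} (centre △) = there (there (here refl))
∈-tile⁺ {△} (centre ▽) = there (there (there (here refl)))
∈-tile⁺ {▽} {a} c∈ rewrite ⊖1+1 a with c∈
... | left     = there (here refl)
... | right    = there (there (here refl))
... | centre △ = there (there (there (here refl)))
... | centre ▽ = here refl

-- The region H_n as an indexed strip, with n = m + 1.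

data Strip (m : ℕ) : Cell → Set where
  outer∈ : ∀ k {a} → a ≤ m → Strip m (outer k a)
  inner∈ : ∀ k {a} → a < m → Strip m (inner k a)

+-cancelʳ-≤ : ∀ k {i j} → i ℤ.+ k ℤ.≤ j ℤ.+ k → i ℤ.≤ j
+-cancelʳ-≤ k {i} {j} i+k≤j+k =
  subst₂ ℤ._≤_ (ℤ-Group.//-rightDividesʳ k i) (ℤ-Group.//-rightDividesʳ k j)
    (ℤ.+-monoˡ-≤ (ℤ.- k) i+k≤j+k)

-- A cell spans the heights y to y + 1 and each trapezoid the heights i to i + 1.
row-unique : ∀ {y} i → i ℤ.≤ y → y ℤ.+ 1ℤ ℤ.≤ i ℤ.+ 1ℤ → y ≡ i
row-unique {y} i i≤y y+1≤i+1 = ℤ.≤-antisym (+-cancelʳ-≤ 1ℤ y+1≤i+1) i≤y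

-- Adding constants to `+ a` in ℤ yields `a + i` rather than `i + a`. The next four lemmas convert
-- such bounds; the version with two summands serves the bound on x + y.
shift≤ : ∀ {a n} i → i + a ≤ n → + (a + i) ℤ.≤ + n
shift≤ {a} i p = +≤+ (ℕ.≤-trans (ℕ.≤-reflexive (ℕ.+-comm a i)) p)

shift₂≤ : ∀ {a n} i j → i + j + a ≤ n → + (a + i + j) ℤ.≤ + n
shift₂≤ {a} i j p = +≤+ (ℕ.≤-trans (ℕ.≤-reflexive (trans (ℕ.+-assoc a i j) (ℕ.+-comm a (i + j)))) p)

unshift≤ : ∀ {a n} i → + (a + i) ℤ.≤ + n → i + a ≤ n
unshift≤ {a} i (+≤+ p) = ℕ.≤-trans (ℕ.≤-reflexive (ℕ.+-comm i a)) p

unshift₂≤ : ∀ {a n} i j → + (a + i + j) ℤ.≤ + n → i + j + a ≤ n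
unshift₂≤ {a} i j (+≤+ p) =
  ℕ.≤-trans (ℕ.≤-reflexive (trans (ℕ.+-comm (i + j) a) (sym (ℕ.+-assoc a i j)))) p

regionH⇒Strip : ∀ {m c} → regionH (suc m) c → Strip m c
regionH⇒Strip {c = up x y} (inj₁ ((0≤y , _ , 0≤x , _) ∷ (_ , _ , _ , x+1≤n) ∷ (_ , y+1≤1 , _) ∷ []))
  with refl ← row-unique 0ℤ 0≤y y+1≤1 | +≤+ {n = a} _ ← 0≤x
  = outer∈ △ (s≤s⁻¹ (unshift₂≤ 1 0 x+1≤n))
regionH⇒Strip {c = down x y} (inj₁ ((0≤y , _) ∷ (_ , y+1≤1 , 0≤x , _) ∷ (_ , _ , _ , x+2≤n) ∷ []))
  with refl ← row-unique 0ℤ 0≤y y+1≤1 | +≤+ {n = a} _ ← 0≤x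
  = inner∈ ▽ (s≤s⁻¹ (unshift₂≤ 1 1 x+2≤n))
regionH⇒Strip {c = up x y} (inj₂ ((1≤y , _ , 1≤x+1 , _) ∷ (_ , _ , _ , x+1≤m) ∷ (_ , y+1≤2 , _) ∷ []))
  with refl ← row-unique 1ℤ 1≤y y+1≤2
  with +≤+ {n = a} _ ← +-cancelʳ-≤ 1ℤ {0ℤ} {x} 1≤x+1
  = inner∈ △ (unshift≤ 1 x+1≤m)
regionH⇒Strip {c = down x y} (inj₂ ((1≤y , _ , _ , x+1≤m) ∷ (_ , y+1≤2 , 1≤x+2 , _) ∷ _ ∷ []))
  with refl ← row-unique 1ℤ 1≤y y+1≤2
  with +-cancelʳ-≤ (+ 2) {ℤ.- 1ℤ} {x} 1≤x+2
-- Here x = -1, the leftmost cell `outer ▽ 0`; in the other case x = a is the column of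
-- `outer ▽ (suc a)`.
... | -≤- z≤n = outer∈ ▽ z≤n
... | -≤+ {n = a} = outer∈ ▽ (unshift≤ 1 x+1≤m)

0≤+ : ∀ {n} → 0ℤ ℤ.≤ + n
0≤+ = +≤+ z≤n

1≤+suc : ∀ {n} → 1ℤ ℤ.≤ + suc n
1≤+suc = +≤+ (s≤s z≤n)

2≤2 : + 2 ℤ.≤ + 2
2≤2 = ℤ.≤-refl

1≤+[+suc] : ∀ a {i} → 1ℤ ℤ.≤ + (a + suc i)
1≤+[+suc] a {i} = +≤+ (ℕ.m≤n⇒m≤o+n a (s≤s z≤n))

Strip⇒regionH : ∀ {m c} → Strip m c → regionH (suc m) c
Strip⇒regionH (outer∈ △ {a} a≤m) = inj₁
  ( (0≤+ , 0≤+ , 0≤+ , shift≤ 0 (ℕ.m≤n⇒m≤1+n a≤m))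
  ∷ (0≤+ , 0≤+ , 0≤+ , shift₂≤ 1 0 (s≤s a≤m))
  ∷ (0≤+ , 1≤+suc , 0≤+ , shift≤ 1 (s≤s a≤m))
  ∷ [])
Strip⇒regionH (inner∈ ▽ {a} a<m) = inj₁
  ( (0≤+ , 0≤+ , 0≤+ , shift₂≤ 1 0 (ℕ.m≤n⇒m≤1+n a<m))
  ∷ (0≤+ , 1≤+suc , 0≤+ , shift≤ 1 (ℕ.m≤n⇒m≤1+n a<m))
  ∷ (0≤+ , 1≤+suc , 0≤+ , shift₂≤ 1 1 (s≤s a<m))
  ∷ [])
Strip⇒regionH (inner∈ △ {a} a<m) = inj₂
  ( (1≤+suc , 1≤+suc , 1≤+[+suc] a , +≤+ (ℕ.<⇒≤ a<m))
  ∷ (1≤+suc , 1≤+suc , 1≤+[+suc] (a + 1) , shift≤ 1 a<m)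
  ∷ (1≤+suc , 2≤2 , 1≤+[+suc] a , +≤+ (ℕ.<⇒≤ a<m))
  ∷ [])
Strip⇒regionH (outer∈ ▽ {zero} 0≤m) = inj₂
  ( (1≤+suc , 1≤+suc , 1≤+suc , 0≤+)
  ∷ (1≤+suc , 2≤2 , 1≤+suc , -≤+)
  ∷ (1≤+suc , 2≤2 , 1≤+suc , 0≤+)
  ∷ [])
Strip⇒regionH (outer∈ ▽ {suc a} a<m) = inj₂
  ( (1≤+suc , 1≤+suc , 1≤+[+suc] (a + 1) , shift≤ 1 a<m)
  ∷ (1≤+suc , 2≤2 , 1≤+[+suc] a , +≤+ (ℕ.<⇒≤ a<m))
  ∷ (1≤+suc , 2≤2 , 1≤+[+suc] (a + 1) , shift≤ 1 a<m)
  ∷ [])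

-- Classification of the tiles contained in the strip.

row : Cell → ℤ
row (up   _ y) = y
row (down _ y) = y

Strip-row : ∀ {m c} → Strip m c → row c ≡ 0ℤ ⊎ row c ≡ 1ℤ
Strip-row (outer∈ △ _) = inj₁ refl
Strip-row (outer∈ ▽ _) = inj₂ refl
Strip-row (inner∈ △ _) = inj₂ refl
Strip-row (inner∈ ▽ _) = inj₁ refl

-- A large tile occupies two consecutive rows, and the strip has only rows 0 and 1.
lower-row : ∀ {y} → y ≡ 0ℤ ⊎ y ≡ 1ℤ → y ℤ.+ 1ℤ ≡ 0ℤ ⊎ y ℤ.+ 1ℤ ≡ 1ℤ → y ≡ 0ℤ
lower-row (inj₁ y≡0)  _ = y≡0
lower-row (inj₂ refl) (inj₁ ())
lower-row (inj₂ refl) (inj₂ ())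

-- The indices of `Strip` are values of the functions `outer` and `inner`, so matching at a given
-- cell would block unification. Here and in the next two lemmas the cell is therefore given by a
-- separate equation.
Strip-down₀ : ∀ {m c x} → Strip m c → c ≡ down x 0ℤ → ∃ λ a → a < m × x ≡ + a
Strip-down₀ (outer∈ △ _)   ()
Strip-down₀ (outer∈ ▽ _)   ()
Strip-down₀ (inner∈ △ _)   ()
Strip-down₀ (inner∈ ▽ a<m) refl = _ , a<m , refl

Strip-inner : ∀ {m c k a} → Strip m c → c ≡ inner k a → a < m
Strip-inner (outer∈ k _)   eq = contradiction eq (outer≢inner {k})
Strip-inner (inner∈ k b<m) eq with refl , refl ← inner-injective {k} eq = b<m

Strip-outer : ∀ {m c k a} → Strip m c → c ≡ outer k a → a ≤ m
Strip-outer (outer∈ k b≤m) eq with refl , refl ← outer-injective {k} eq = b≤m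
Strip-outer (inner∈ k _)   eq = contradiction (sym eq) outer≢inner

-- The row of a large tile is forced to be 0. Its only `down` cell in row 0 must then be an inner
-- cell of the strip, and this gives its position.
tile-view : ∀ {m} t → (∀ {c} → c ∈ cells t → Strip m c) →
            (∃ λ c → t ≡ small c) ⊎ (∃₂ λ k a → t ≡ tile k a)
tile-view (small c) _ = inj₁ (c , refl)
tile-view (large-up x y) ⊆strip
  with refl ← lower-row (Strip-row (⊆strip (here refl)))
                        (Strip-row (⊆strip (there (there (here refl)))))
  with a , _ , refl ← Strip-down₀ (⊆strip (there (there (there (here refl))))) refl
  = inj₂ (△ , a , refl)
tile-view (large-down x y) ⊆strip
  with refl ← lower-row (Strip-row (⊆strip (here refl)))
                        (Strip-row (⊆strip (there (here refl))))
  with a , _ , x+1≡a ← Strip-down₀ (⊆strip (here refl)) refl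
  with refl ← ℤ-Group.∙-cancelʳ 1ℤ x (a ⊖ 1) (trans x+1≡a (sym (⊖1+1 a)))
  = inj₂ (▽ , a , refl)

-- Enumeration of the strip and decidable equality of cells and tiles.

sides : List Side
sides = △ ∷ ▽ ∷ []

∈-sides : ∀ k → k ∈ sides
∈-sides △ = here refl
∈-sides ▽ = there (here refl)

stripCells : ℕ → List Cell
stripCells m = cartesianProductWith outer sides (upTo (suc m))
            ++ cartesianProductWith inner sides (upTo m)

∈-stripCells⁺ : ∀ {m c} → Strip m c → c ∈ stripCells m
∈-stripCells⁺ (outer∈ k a≤m) =
  ∈-++⁺ˡ (∈-cartesianProductWith⁺ outer (∈-sides k) (∈-upTo⁺ (s≤s a≤m)))
∈-stripCells⁺ {m} (inner∈ k a<m) =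
  ∈-++⁺ʳ (cartesianProductWith outer sides (upTo (suc m)))
    (∈-cartesianProductWith⁺ inner (∈-sides k) (∈-upTo⁺ a<m))

∈-stripCells⁻ : ∀ {m c} → c ∈ stripCells m → Strip m c
∈-stripCells⁻ {m} c∈ with ∈-++⁻ (cartesianProductWith outer sides (upTo (suc m))) c∈
... | inj₁ p with k , a , _ , a∈ , refl ← ∈-cartesianProductWith⁻ outer sides (upTo (suc m)) p
    = outer∈ k (s≤s⁻¹ (∈-upTo⁻ a∈))
... | inj₂ p with k , a , _ , a∈ , refl ← ∈-cartesianProductWith⁻ inner sides (upTo m) p
    = inner∈ k (∈-upTo⁻ a∈)

_≟ᶜ_ : DecidableEquality Cell
up   a b ≟ᶜ up   a′ b′ =
  map′ (λ { (refl , refl) → refl }) (λ { refl → refl , refl }) ((a ℤ.≟ a′) ×-dec (b ℤ.≟ b′))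
up   _ _ ≟ᶜ down _  _  = no λ ()
down _ _ ≟ᶜ up   _  _  = no λ ()
down a b ≟ᶜ down a′ b′ =
  map′ (λ { (refl , refl) → refl }) (λ { refl → refl , refl }) ((a ℤ.≟ a′) ×-dec (b ℤ.≟ b′))

_≟ᵗ_ : DecidableEquality Tile
small c ≟ᵗ small c′ = map′ (cong small) (λ { refl → refl }) (c ≟ᶜ c′)
large-up a b ≟ᵗ large-up a′ b′ =
  map′ (λ { (refl , refl) → refl }) (λ { refl → refl , refl }) ((a ℤ.≟ a′) ×-dec (b ℤ.≟ b′))
large-down a b ≟ᵗ large-down a′ b′ =
  map′ (λ { (refl , refl) → refl }) (λ { refl → refl , refl }) ((a ℤ.≟ a′) ×-dec (b ℤ.≟ b′))
small _        ≟ᵗ large-up _ _   = no λ ()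
small _        ≟ᵗ large-down _ _ = no λ ()
large-up _ _   ≟ᵗ small _        = no λ ()
large-up _ _   ≟ᵗ large-down _ _ = no λ ()
large-down _ _ ≟ᵗ small _        = no λ ()
large-down _ _ ≟ᵗ large-up _ _   = no λ ()

open DecMembership _≟ᶜ_ using () renaming (_∈?_ to _∈ᶜ?_)
open DecMembership _≟ᵗ_ using () renaming (_∈?_ to _∈ᵗ?_)

-- Words and the large tiles they place.

Letter : Set
Letter = Maybe Side

-- Of the cells of a large tile at position `m`, only the left outer one lies in `Strip m`.
rim : Letter → ℕ → List Cell
rim nothing  m = []
rim (just k) m = outer k m ∷ []

-- What a large tile l placed at position m leaves of the strip before it.
Remaining : Letter → ℕ → Region
Remaining l m c = Strip m c × c ∉ rim l m

∈-rim⁻ : ∀ l {m c} → c ∈ rim l m → ∃ λ j → l ≡ just j × c ≡ outer j m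
∈-rim⁻ (just j) (here c≡) = j , refl , c≡

-- Equivalent to the inclusion of `tile k a` in `Remaining l m`; `precedes⇒⊆` and `⊆⇒precedes` are
-- the two directions.
Precedes : Side → ℕ → Letter → ℕ → Set
Precedes k a l m = a < m × (suc a ≡ m → l ≢ just k)

-- Only the right outer cell can meet the rim, and only if the positions are adjacent and the
-- directions equal.
precedes⇒⊆ : ∀ {k a l m c} → Precedes k a l m → c ∈ cells (tile k a) → Remaining l m c
precedes⇒⊆ {k} {a} {l} {m} (a<m , clash) c∈ with ∈-tile⁻ k c∈
... | left = outer∈ k (ℕ.<⇒≤ a<m) , λ c∈rim →
  case ∈-rim⁻ l c∈rim of λ { (j , _ , eq) → ℕ.<⇒≢ a<m (proj₂ (outer-injective {k} {j} eq)) }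
... | right = outer∈ k a<m , λ c∈rim → case ∈-rim⁻ l c∈rim of λ
  { (j , refl , eq) → let k≡j , a+1≡m = outer-injective {k} {j} eq in
                      clash a+1≡m (cong just (sym k≡j)) }
... | centre j = inner∈ j a<m , λ c∈rim →
  case ∈-rim⁻ l c∈rim of λ { (i , _ , eq) → outer≢inner {i} {j} (sym eq) }

⊆⇒precedes : ∀ {k a l m} → (∀ {c} → c ∈ cells (tile k a) → Remaining l m c) → Precedes k a l m
⊆⇒precedes {k} {a} ⊆rem =
  Strip-inner (proj₁ (⊆rem (∈-tile⁺ (centre k)))) refl ,
  λ { refl refl → proj₂ (⊆rem (∈-tile⁺ {k} right)) (here refl) }

tile-outside : ∀ {k m c} → c ∈ cells (tile k m) → ¬ Remaining (just k) m c
tile-outside {k} {m} c∈ (c∈strip , c∉rim) with ∈-tile⁻ k c∈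
... | left     = c∉rim (here refl)
... | right    = ℕ.1+n≰n (Strip-outer {k = k} c∈strip refl)
... | centre j = ℕ.1+n≰n (Strip-inner {k = j} c∈strip refl)

-- The proof is irrelevant so that equality of words is equality of letters.
data Word : Letter → ℕ → Set where
  []  : ∀ {l} → Word l 0
  put : ∀ {l m} (k : Letter) → .(∀ j → k ≡ just j → l ≢ just j) → Word k m → Word l (suc m)

-- `put` adds the last letter, whose position is the length `m` of the word before it. The index `l`
-- of a word is the letter that follows it.
placements : ∀ {l m} → Word l m → List (Side × ℕ)
placements []                   = []
placements (put nothing _ w)    = placements w
placements (put {m = m} (just k) _ w) = (k , m) ∷ placements w

-- A tile at a position below `m` is not adjacent to position `suc m`, so any letter may stand
-- there.
precedes-suc : ∀ {k a j m} l → Precedes k a j m → Precedes k a l (suc m)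
precedes-suc l (a<m , _) =
  ℕ.m<n⇒m<1+n a<m , λ 1+a≡1+m → contradiction (ℕ.suc-injective 1+a≡1+m) (ℕ.<⇒≢ a<m)

placed-precedes : ∀ {l m k a} (w : Word l m) → (k , a) ∈ placements w → Precedes k a l m
placed-precedes {l} (put nothing  _  w) p∈           = precedes-suc l (placed-precedes w p∈)
placed-precedes {l} (put (just k) ok w) (here refl)  =
  ℕ.≤-refl , λ _ l≡k → ⊥-elim-irr (ok k refl l≡k)
placed-precedes {l} (put (just _) _  w) (there p∈)   = precedes-suc l (placed-precedes w p∈)

-- Of two tiles, the earlier lies in what the later leaves of the strip (`precedes⇒⊆`), and no cell
-- of the later does (`tile-outside`).
placed-disjoint : ∀ {l m p q} (w : Word l m) → p ∈ placements w → q ∈ placements w → p ≢ q →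
                  Disjoint (cells (uncurry tile p)) (cells (uncurry tile q))
placed-disjoint (put nothing _ w) p∈ q∈ p≢q = placed-disjoint w p∈ q∈ p≢q
placed-disjoint (put (just k) _ w) (here refl) (here refl) p≢q = contradiction refl p≢q
placed-disjoint (put (just k) _ w) (here refl) (there q∈) _ (c∈p , c∈q) =
  tile-outside {k} c∈p (precedes⇒⊆ (placed-precedes w q∈) c∈q)
placed-disjoint (put (just k) _ w) (there p∈) (here refl) _ (c∈p , c∈q) =
  tile-outside {k} c∈q (precedes⇒⊆ (placed-precedes w p∈) c∈p)
placed-disjoint (put (just _) _ w) (there p∈) (there q∈) p≢q = placed-disjoint w p∈ q∈ p≢q

-- All positions in the word before the last letter are below `m`, so the entry at position `m`, or
-- its absence, determines the last letter. Mutual inclusion is assumed because tilings are compared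
-- as sets.
placements-injective : ∀ {l m} (w v : Word l m) →
                       placements w ⊆ placements v → placements v ⊆ placements w → w ≡ v
placements-injective [] [] _ _ = refl
placements-injective (put nothing _ w) (put nothing _ v) w⊆v v⊆w =
  cong (put nothing _) (placements-injective w v w⊆v v⊆w)
placements-injective (put nothing _ w) (put (just _) _ v) _ v⊆w =
  contradiction (proj₁ (placed-precedes w (v⊆w (here refl)))) (ℕ.<-irrefl refl)
placements-injective (put (just _) _ w) (put nothing _ v) w⊆v _ =
  contradiction (proj₁ (placed-precedes v (w⊆v (here refl)))) (ℕ.<-irrefl refl)
placements-injective (put (just _) _ w) (put (just _) _ v) w⊆v v⊆w with w⊆v (here refl)
... | there p∈ = contradiction (proj₁ (placed-precedes v p∈)) (ℕ.<-irrefl refl)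
... | here refl = cong (put _ _) (placements-injective w v (tail w v w⊆v) (tail v w v⊆w))
  where
  tail : ∀ {k m} (w v : Word (just k) m) →
         (k , m) ∷ placements w ⊆ (k , m) ∷ placements v → placements w ⊆ placements v
  tail w v w⊆v p∈ with w⊆v (there p∈)
  ... | here refl = contradiction (proj₁ (placed-precedes w p∈)) (ℕ.<-irrefl refl)
  ... | there p∈v = p∈v

-- The word spelled by a decidable set of large tiles.

module _ (S : Side → ℕ → Set) (S? : ∀ k a → Dec (S k a))
         (exclusive : ∀ {k j a} → S k a → S j a → k ≡ j)
         (isolated : ∀ {k a} → S k a → ¬ S k (suc a)) where

  letter : ∀ a → (∃ λ k → S k a) ⊎ (∀ k → ¬ S k a)
  letter a with S? △ a | S? ▽ a
  ... | yes s | _     = inj₁ (△ , s)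
  ... | no _  | yes s = inj₁ (▽ , s)
  ... | no ¬s | no ¬t = inj₂ λ { △ → ¬s ; ▽ → ¬t }

  -- Letters are read from the last position down. `exclusive` makes the letter at a position
  -- unique, and `isolated` supplies the compatibility of the remaining word with the letter just
  -- read.
  word-of : ∀ l m → (∀ {k a} → suc a ≡ m → S k a → l ≢ just k) →
            Σ[ w ∈ Word l m ] (∀ k a → (k , a) ∈ placements w ⇔ (S k a × a < m))
  word-of l zero    _  = [] , λ k a → mk⇔ (λ ()) (λ ())
  word-of l (suc m) ok with letter m
  ... | inj₁ (j , s) with word-of (just j) m (λ { refl s′ refl → isolated s′ s })
  ...   | w , spec = put (just j) (λ { i refl → ok refl s }) w , λ k a → mk⇔
          (λ { (here refl) → s , ℕ.≤-refl
             ; (there p∈)  → let s , a<m = Equivalence.to (spec k a) p∈ in s , ℕ.m<n⇒m<1+n a<m })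
          (λ (s′ , a<1+m) → case ℕ.m<1+n⇒m<n∨m≡n a<1+m of λ
             { (inj₁ a<m)  → there (Equivalence.from (spec k a) (s′ , a<m))
             ; (inj₂ refl) → here (cong (_, a) (exclusive s′ s)) })
  word-of l (suc m) ok | inj₂ none with word-of nothing m (λ _ _ ())
  ...   | w , spec = put nothing (λ _ ()) w , λ k a → mk⇔
          (λ p∈ → let s , a<m = Equivalence.to (spec k a) p∈ in s , ℕ.m<n⇒m<1+n a<m)
          (λ (s′ , a<1+m) → case ℕ.m<1+n⇒m<n∨m≡n a<1+m of λ
             { (inj₁ a<m)  → Equivalence.from (spec k a) (s′ , a<m)
             ; (inj₂ refl) → contradiction s′ (none k) })

-- The bijection between tilings and words.

Covered : List (Side × ℕ) → Cell → Set
Covered ps c = Any (λ p → c ∈ cells (uncurry tile p)) ps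

covered? : ∀ ps c → Dec (Covered ps c)
covered? ps c = Any.any? (λ p → c ∈ᶜ? cells (uncurry tile p)) ps

-- `R` is abstract so that one bijection serves H_n, with `l = nothing`, and P_n, with `l = just △`.
module _ {R : Region} {l : Letter} {m : ℕ}
         (R⇒ : ∀ {c} → R c → Remaining l m c) (⇒R : ∀ {c} → Remaining l m c → R c) where

  open Tiling

  off-rim? : ∀ c → Dec (c ∉ rim l m)
  off-rim? c = ¬? (c ∈ᶜ? rim l m)

  uncovered? : ∀ ps c → Dec (¬ Covered ps c)
  uncovered? ps c = ¬? (covered? ps c)

  region-cells : List Cell
  region-cells = filter off-rim? (stripCells m)

  uncovered : List (Side × ℕ) → List Cell
  uncovered ps = filter (uncovered? ps) region-cells

  ∈-uncovered⁺ : ∀ ps {c} → R c → ¬ Covered ps c → c ∈ uncovered ps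
  ∈-uncovered⁺ ps Rc ¬cov with c∈strip , c∉rim ← R⇒ Rc =
    ∈-filter⁺ (uncovered? ps) (∈-filter⁺ off-rim? (∈-stripCells⁺ c∈strip) c∉rim) ¬cov

  ∈-uncovered⁻ : ∀ ps {c} → c ∈ uncovered ps → R c × ¬ Covered ps c
  ∈-uncovered⁻ ps c∈ with c∈cells , ¬cov ← ∈-filter⁻ (uncovered? ps) {xs = region-cells} c∈
    with c∈strip , c∉rim ← ∈-filter⁻ off-rim? {xs = stripCells m} c∈cells =
    ⇒R (∈-stripCells⁻ c∈strip , c∉rim) , ¬cov

  tiles-of : List (Side × ℕ) → List Tile
  tiles-of ps = map (uncurry tile) ps ++ map small (uncovered ps)

  data TileOf (ps : List (Side × ℕ)) : Tile → Set where
    placed : ∀ {p} → p ∈ ps → TileOf ps (uncurry tile p)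
    filler : ∀ {c} → R c → ¬ Covered ps c → TileOf ps (small c)

  ∈-tiles-of⁻ : ∀ ps {t} → t ∈ tiles-of ps → TileOf ps t
  ∈-tiles-of⁻ ps t∈ with ∈-++⁻ (map (uncurry tile) ps) t∈
  ... | inj₁ t∈large with p , p∈ , refl ← ∈-map⁻ (uncurry tile) t∈large = placed p∈
  ... | inj₂ t∈small with c , c∈ , refl ← ∈-map⁻ small t∈small
      = uncurry filler (∈-uncovered⁻ ps c∈)

  tile∈tiles-of⁺ : ∀ {ps p} → p ∈ ps → uncurry tile p ∈ tiles-of ps
  tile∈tiles-of⁺ p∈ = ∈-++⁺ˡ (∈-map⁺ (uncurry tile) p∈)

  tile∈tiles-of⁻ : ∀ {ps t k a} → t ∈ tiles-of ps → t ≡ tile k a → (k , a) ∈ ps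
  tile∈tiles-of⁻ {ps} t∈ eq with ∈-tiles-of⁻ ps t∈
  ... | placed {j , _} p∈ with refl , refl ← tile-injective {j} eq = p∈
  ... | filler _ _ = contradiction (sym eq) tile≢small

  encode : Word l m → Tiling R
  encode w .tiles = tiles-of (placements w)
  encode w .contained t∈ c∈ with ∈-tiles-of⁻ (placements w) t∈
  ... | placed p∈ = ⇒R (precedes⇒⊆ (placed-precedes w p∈) c∈)
  ... | filler Rc _ with here refl ← c∈ = Rc
  encode w .disjoint t∈ u∈ t≢u (c∈t , c∈u)
    with ∈-tiles-of⁻ (placements w) t∈ | ∈-tiles-of⁻ (placements w) u∈
  ... | placed p∈ | placed q∈ = placed-disjoint w p∈ q∈ (t≢u ∘ cong (uncurry tile)) (c∈t , c∈u)
  ... | placed p∈ | filler _ ¬cov with here refl ← c∈u = ¬cov (lose p∈ c∈t)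
  ... | filler _ ¬cov | placed q∈ with here refl ← c∈t = ¬cov (lose q∈ c∈u)
  ... | filler _ _ | filler _ _ with here refl ← c∈t | here refl ← c∈u = t≢u refl
  encode w .covering {c} Rc with covered? (placements w) c
  ... | yes cov with p , p∈ , c∈p ← find cov = lose (tile∈tiles-of⁺ p∈) c∈p
  ... | no ¬cov = lose (∈-++⁺ʳ (map (uncurry tile) (placements w))
                         (∈-map⁺ small (∈-uncovered⁺ (placements w) Rc ¬cov))) (here refl)

  SameLarge : (T U : Tiling R) → Set
  SameLarge T U = ∀ k a → tile k a ∈ tiles T → tile k a ∈ tiles U

  -- The cell of a small tile of T cannot be covered by a large tile of U, since
  -- that tile would also belong to T.
  determined : ∀ T U → SameLarge T U → SameLarge U T → tiles T ⊆ tiles U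
  determined T U T⊆U U⊆T {t} t∈T with tile-view t (proj₁ ∘ R⇒ ∘ contained T t∈T)
  ... | inj₂ (k , a , refl) = T⊆U k a t∈T
  ... | inj₁ (c , refl)
    with u , u∈U , c∈u ← find (covering U (contained T t∈T (here refl)))
    with tile-view u (proj₁ ∘ R⇒ ∘ contained U u∈U)
  ... | inj₁ (_ , refl) with here refl ← c∈u = u∈U
  ... | inj₂ (k , a , refl) =
    contradiction (here refl , c∈u) (disjoint T t∈T (U⊆T k a u∈U) (tile≢small ∘ sym))

  placed-in : ∀ (T : Tiling R) {k a} → tile k a ∈ tiles T → Precedes k a l m
  placed-in T t∈ = ⊆⇒precedes (R⇒ ∘ contained T t∈)

  decode-spec : (T : Tiling R) →
                Σ[ w ∈ Word l m ] (∀ k a → (k , a) ∈ placements w ⇔ (tile k a ∈ tiles T × a < m))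
  decode-spec T = word-of (λ k a → tile k a ∈ tiles T) (λ k a → tile k a ∈ᵗ? tiles T)
    -- Large tiles at one position share their inner cells, so disjointness forces equal directions.
    (λ {k} {j} {a} k∈ j∈ → decidable-stable (k ≟ˢ j) λ k≢j →
      disjoint T k∈ j∈ (k≢j ∘ proj₁ ∘ tile-injective)
        (∈-tile⁺ {k} (centre △) , ∈-tile⁺ {j} (centre △)))
    -- The right outer cell of a tile is the left outer cell of the next tile of the same direction.
    (λ {k} {a} k∈ k∈′ → disjoint T k∈ k∈′ (ℕ.1+n≢n ∘ sym ∘ proj₂ ∘ tile-injective {k} {k})
        (∈-tile⁺ {k} right , ∈-tile⁺ {k} left))
    l m (λ a+1≡m k∈ → proj₂ (placed-in T k∈) a+1≡m)

  decode : Tiling R → Word l m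
  decode T = proj₁ (decode-spec T)

  decode⁻ : ∀ T {k a} → (k , a) ∈ placements (decode T) → tile k a ∈ tiles T
  decode⁻ T {k} {a} p∈ = proj₁ (Equivalence.to (proj₂ (decode-spec T) k a) p∈)

  decode⁺ : ∀ T {k a} → tile k a ∈ tiles T → (k , a) ∈ placements (decode T)
  decode⁺ T {k} {a} t∈ =
    Equivalence.from (proj₂ (decode-spec T) k a) (t∈ , proj₁ (placed-in T t∈))

  -- Both inverse laws need only a comparison of large tiles: `placements-injective` then identifies
  -- the words and `determined` the tilings.
  tilings↔words : Inverse (tilings R) (setoid (Word l m))
  tilings↔words = record
    { to        = decode
    ; from      = encode
    ; to-cong   = λ {T} {U} T≈U → placements-injective (decode T) (decode U)
        (λ p∈ → decode⁺ U (Equivalence.to   T≈U (decode⁻ T p∈)))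
        (λ p∈ → decode⁺ T (Equivalence.from T≈U (decode⁻ U p∈)))
    ; from-cong = λ { refl → mk⇔ (λ t∈ → t∈) (λ t∈ → t∈) }
    ; inverse   =
        (λ {w} {T} T≈w → placements-injective (decode T) w
          (λ p∈ → tile∈tiles-of⁻ (Equivalence.to T≈w (decode⁻ T p∈)) refl)
          (λ p∈ → decode⁺ T (Equivalence.from T≈w (tile∈tiles-of⁺ p∈))))
      , (λ { {T} refl →
          let w⊆T = λ k a t∈ → decode⁻ T (tile∈tiles-of⁻ t∈ refl)
              T⊆w = λ k a t∈ → tile∈tiles-of⁺ (decode⁺ T t∈)
          in mk⇔ (determined (encode (decode T)) T w⊆T T⊆w)
                 (determined T (encode (decode T)) T⊆w w⊆T) })
    }

-- Counting words by deleting the last letter.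

-- Numbers of words of length m before a blank and before a large tile.
free blocked : ℕ → ℕ
free zero       = 1
free (suc m)    = free m + (blocked m + blocked m)
blocked zero    = 1
blocked (suc m) = free m + blocked m

opposite : Side → Side
opposite △ = ▽
opposite ▽ = △

≢opposite : ∀ {k} → k ≢ opposite k
≢opposite {△} ()
≢opposite {▽} ()

empty-word : ∀ {l} → Word l 0 ↔ Fin 1
empty-word = mk↔ₛ′ (λ _ → zero) (λ _ → []) (λ { zero → refl }) (λ { [] → refl })

last-free : ∀ {m} → Word nothing (suc m) ↔ (Word nothing m ⊎ (Word (just △) m ⊎ Word (just ▽) m))
last-free = mk↔ₛ′
  (λ { (put nothing _ w)  → inj₁ w
     ; (put (just △) _ w) → inj₂ (inj₁ w)
     ; (put (just ▽) _ w) → inj₂ (inj₂ w) })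
  (λ { (inj₁ w)        → put nothing (λ _ _ ()) w
     ; (inj₂ (inj₁ w)) → put (just △) (λ _ _ ()) w
     ; (inj₂ (inj₂ w)) → put (just ▽) (λ _ _ ()) w })
  (λ { (inj₁ w) → refl ; (inj₂ (inj₁ w)) → refl ; (inj₂ (inj₂ w)) → refl })
  (λ { (put nothing _ w) → refl ; (put (just △) _ w) → refl ; (put (just ▽) _ w) → refl })

-- Before `just k` only a blank or the opposite side may stand. The excluded letter is refuted from
-- an irrelevant proof, hence `⊥-elim-irr`.
last-blocked : ∀ k {m} → Word (just k) (suc m) ↔ (Word nothing m ⊎ Word (just (opposite k)) m)
last-blocked k = mk↔ₛ′ (to k) from (to∘from k) (from∘to k)
  where
  to : ∀ k {m} → Word (just k) (suc m) → Word nothing m ⊎ Word (just (opposite k)) m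
  to k (put nothing _ w)   = inj₁ w
  to △ (put (just △) ok w) = ⊥-elim-irr (ok △ refl refl)
  to △ (put (just ▽) _ w)  = inj₂ w
  to ▽ (put (just △) _ w)  = inj₂ w
  to ▽ (put (just ▽) ok w) = ⊥-elim-irr (ok ▽ refl refl)

  from : ∀ {k m} → Word nothing m ⊎ Word (just (opposite k)) m → Word (just k) (suc m)
  from         (inj₁ w) = put nothing (λ _ ()) w
  from {k = k} (inj₂ w) = put (just (opposite k)) (λ { _ refl k≡ → ≢opposite (just-injective k≡) }) w

  to∘from : ∀ k {m} (w : Word nothing m ⊎ Word (just (opposite k)) m) → to k (from w) ≡ w
  to∘from △ (inj₁ w) = refl
  to∘from ▽ (inj₁ w) = refl
  to∘from △ (inj₂ w) = refl
  to∘from ▽ (inj₂ w) = refl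

  from∘to : ∀ k {m} (w : Word (just k) (suc m)) → from (to k w) ≡ w
  from∘to △ (put nothing _ w)   = refl
  from∘to ▽ (put nothing _ w)   = refl
  from∘to △ (put (just △) ok w) = ⊥-elim-irr (ok △ refl refl)
  from∘to △ (put (just ▽) _ w)  = refl
  from∘to ▽ (put (just △) _ w)  = refl
  from∘to ▽ (put (just ▽) ok w) = ⊥-elim-irr (ok ▽ refl refl)

-- Stated for both sides, since deleting `opposite k` leaves a word followed by `opposite k`; the
-- count is the same for either side.
count-blocked : ∀ k m → Word (just k) m ↔ Fin (blocked m)
count-free    : ∀ m → Word nothing m ↔ Fin (free m)

count-blocked k zero    = empty-word
count-blocked k (suc m) =
  ↔-sym +↔⊎ ↔-∘ ((count-free m ⊎-↔ count-blocked (opposite k) m) ↔-∘ last-blocked k)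

count-free zero    = empty-word
count-free (suc m) =
  ↔-sym +↔⊎ ↔-∘
  ((count-free m ⊎-↔ (↔-sym +↔⊎ ↔-∘ (count-blocked △ m ⊎-↔ count-blocked ▽ m))) ↔-∘ last-free)

-- Tiling numbers of H_n and P_n and their recurrences.

count-H : ∀ m → HasTilingCount (regionH (suc m)) (free m)
count-H m = inverse (tilings↔words {l = nothing} (λ c∈ → regionH⇒Strip c∈ , λ ()) (Strip⇒regionH ∘ proj₁))
                    (count-free m)

-- The cell removed from H_n is `outer △ m` with m = n - 1, exactly the rim of a △ placed at
-- position `m`.
count-P : ∀ m → HasTilingCount (regionP (suc m)) (blocked m)
count-P m = inverse
  (tilings↔words {l = just △} (λ (c∈ , c≢) → regionH⇒Strip c∈ , λ { (here c≡) → c≢ c≡ })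
                 (λ (c∈ , c∉) → Strip⇒regionH c∈ , c∉ ∘ here))
  (count-blocked △ m)

free-suc : ∀ m → free (suc m) ≡ free m + 2 * blocked m
free-suc m = cong (λ b → free m + (blocked m + b)) (sym (ℕ.+-identityʳ (blocked m)))

free-pell : ∀ m → free (suc (suc m)) ≡ 2 * free (suc m) + free m
free-pell m = identity (free m) (blocked m)
  where
  identity : ∀ f b → f + (b + b) + (f + b + (f + b)) ≡ 2 * (f + (b + b)) + f
  identity = solve-∀

blocked-pell : ∀ m → blocked (suc (suc m)) ≡ 2 * blocked (suc m) + blocked m
blocked-pell m = identity (free m) (blocked m)
  where
  identity : ∀ f b → f + (b + b) + (f + b) ≡ 2 * (f + b) + b
  identity = solve-∀

blocked≡pell : ∀ m → blocked m ≡ pell (suc m)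
blocked≡pell zero          = refl
blocked≡pell (suc zero)    = refl
blocked≡pell (suc (suc m)) = trans (blocked-pell m)
  (cong₂ (λ x y → 2 * x + y) (blocked≡pell (suc m)) (blocked≡pell m))

-- Closed forms from powers of 1 + r and 1 - r.

module PellPowers {c ℓ} (R : CommutativeRing c ℓ) where

  open CommutativeRing R
    renaming (_+_ to _⊕_; _*_ to _⊗_; setoid to R-setoid; refl to ≈-refl; trans to ≈-trans)
    hiding (sym)
  open Exp semiring using (_^_)
  open Mult semiring using (×-homo-+) renaming (_×_ to _·_)
  open RingProperties ring using (-‿distribˡ-*; -‿distribʳ-*; -‿involutive; -0#≈0#; //-rightDividesʳ)
  open SetoidReasoning R-setoid
  open import Algebra.Solver.Ring.NaturalCoefficients.Default commutativeSemiring
    using (solve; _:=_; _:+_; _:*_; con)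

  ⟦_⟧ : ℕ → Carrier
  ⟦ n ⟧ = n · 1#

  ⟦1⟧≈1 : ⟦ 1 ⟧ ≈ 1#
  ⟦1⟧≈1 = +-identityʳ 1#

  x⟦2⟧≈x+x : ∀ x → x ⊗ ⟦ 2 ⟧ ≈ x ⊕ x
  x⟦2⟧≈x+x x = ≈-trans (*-congˡ (+-congˡ ⟦1⟧≈1)) (solve 1 (λ x → x :* con 2 := x :+ x) ≈-refl x)

  -- Multiplication by 1 + s sends f + b s to (f + 2b) + (f + b) s, which is the recurrence of
  -- `free` and `blocked`. It is used for both square roots, r and -r.
  power : ∀ s → s ⊗ s ≈ ⟦ 2 ⟧ → ∀ m → (1# ⊕ s) ^ suc m ≈ ⟦ free m ⟧ ⊕ ⟦ blocked m ⟧ ⊗ s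
  power s s²≈2 zero = begin
    (1# ⊕ s) ⊗ 1#        ≈⟨ *-identityʳ _ ⟩
    1# ⊕ s               ≈⟨ +-cong ⟦1⟧≈1 (≈-trans (*-congʳ ⟦1⟧≈1) (*-identityˡ s)) ⟨
    ⟦ 1 ⟧ ⊕ ⟦ 1 ⟧ ⊗ s    ∎
  power s s²≈2 (suc m) = begin
    (1# ⊕ s) ⊗ (1# ⊕ s) ^ suc m        ≈⟨ *-congˡ (power s s²≈2 m) ⟩
    (1# ⊕ s) ⊗ (f ⊕ b ⊗ s)             ≈⟨ ≈-trans (distribʳ _ _ _) (+-congʳ (*-identityˡ _)) ⟩
    (f ⊕ b ⊗ s) ⊕ s ⊗ (f ⊕ b ⊗ s)
      ≈⟨ solve 3 (λ f b s → (f :+ b :* s) :+ s :* (f :+ b :* s)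
                         := (f :+ (b :+ f) :* s) :+ b :* (s :* s)) ≈-refl f b s ⟩
    (f ⊕ (b ⊕ f) ⊗ s) ⊕ b ⊗ (s ⊗ s)    ≈⟨ +-congˡ (≈-trans (*-congˡ s²≈2) (x⟦2⟧≈x+x b)) ⟩
    (f ⊕ (b ⊕ f) ⊗ s) ⊕ (b ⊕ b)
      ≈⟨ solve 3 (λ f b s → (f :+ (b :+ f) :* s) :+ (b :+ b)
                         := (f :+ (b :+ b)) :+ (f :+ b) :* s) ≈-refl f b s ⟩
    (f ⊕ (b ⊕ b)) ⊕ (f ⊕ b) ⊗ s
      ≈⟨ +-cong (≈-trans (×-homo-+ 1# (free m) _) (+-congˡ (×-homo-+ 1# (blocked m) (blocked m))))
                (*-congʳ (×-homo-+ 1# (free m) (blocked m))) ⟨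
    ⟦ free (suc m) ⟧ ⊕ ⟦ blocked (suc m) ⟧ ⊗ s  ∎
    where
    f b : Carrier
    f = ⟦ free m ⟧
    b = ⟦ blocked m ⟧

  [-x]²≈x² : ∀ x → - x ⊗ - x ≈ x ⊗ x
  [-x]²≈x² x = begin
    - x ⊗ - x      ≈⟨ -‿distribˡ-* x (- x) ⟨
    - (x ⊗ - x)    ≈⟨ -‿cong (-‿distribʳ-* x x) ⟨
    - - (x ⊗ x)    ≈⟨ -‿involutive (x ⊗ x) ⟩
    x ⊗ x          ∎

  module _ (r : Carrier) (r²≈2 : r ⊗ r ≈ ⟦ 2 ⟧) (m : ℕ) where

    private
      f b : Carrier
      f = ⟦ free m ⟧
      b = ⟦ blocked m ⟧

      b[r-r]≈0 : b ⊗ (r ⊕ - r) ≈ 0#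
      b[r-r]≈0 = ≈-trans (*-congˡ (-‿inverseʳ r)) (zeroʳ b)

      power⁺ : (1# ⊕ r) ^ suc m ≈ f ⊕ b ⊗ r
      power⁺ = power r r²≈2 m

      power⁻ : (1# - r) ^ suc m ≈ f ⊕ b ⊗ - r
      power⁻ = power (- r) (≈-trans ([-x]²≈x² r) r²≈2) m

    power-sum : (1# ⊕ r) ^ suc m ⊕ (1# - r) ^ suc m ≈ f ⊗ ⟦ 2 ⟧
    power-sum = begin
      (1# ⊕ r) ^ suc m ⊕ (1# - r) ^ suc m   ≈⟨ +-cong power⁺ power⁻ ⟩
      (f ⊕ b ⊗ r) ⊕ (f ⊕ b ⊗ - r)
        -- The solver works over semirings, so `- r` enters as an independent variable `t`;
        -- `b[r-r]≈0` cancels it afterwards.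
        ≈⟨ solve 4 (λ f b r t → (f :+ b :* r) :+ (f :+ b :* t)
                             := (f :+ f) :+ b :* (r :+ t)) ≈-refl f b r (- r) ⟩
      (f ⊕ f) ⊕ b ⊗ (r ⊕ - r)               ≈⟨ +-congˡ b[r-r]≈0 ⟩
      (f ⊕ f) ⊕ 0#                          ≈⟨ +-identityʳ _ ⟩
      f ⊕ f                                 ≈⟨ x⟦2⟧≈x+x f ⟨
      f ⊗ ⟦ 2 ⟧                             ∎

    power-difference : (1# ⊕ r) ^ suc m - (1# - r) ^ suc m ≈ b ⊗ (⟦ 2 ⟧ ⊗ r)
    power-difference = begin
      (1# ⊕ r) ^ suc m - q                  ≈⟨ +-congʳ power⁺ ⟩
      -- Adding zero in the form `b ⊗ (r ⊕ - r)` exposes the summand `f ⊕ b ⊗ - r`, which is `q` and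
      -- cancels.
      (f ⊕ b ⊗ r) - q                       ≈⟨ +-congʳ (+-identityʳ _) ⟨
      (f ⊕ b ⊗ r) ⊕ 0# - q                  ≈⟨ +-congʳ (+-congˡ b[r-r]≈0) ⟨
      (f ⊕ b ⊗ r) ⊕ b ⊗ (r ⊕ - r) - q
        ≈⟨ +-congʳ (solve 4 (λ f b r t → (f :+ b :* r) :+ b :* (r :+ t)
                             := b :* (r :+ r) :+ (f :+ b :* t)) ≈-refl f b r (- r)) ⟩
      b ⊗ (r ⊕ r) ⊕ (f ⊕ b ⊗ - r) - q       ≈⟨ +-congʳ (+-congˡ power⁻) ⟨
      b ⊗ (r ⊕ r) ⊕ q - q                   ≈⟨ //-rightDividesʳ q _ ⟩
      b ⊗ (r ⊕ r)                           ≈⟨ *-congˡ (≈-trans (*-comm ⟦ 2 ⟧ r) (x⟦2⟧≈x+x r)) ⟨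
      b ⊗ (⟦ 2 ⟧ ⊗ r)                       ∎
      where
      q : Carrier
      q = (1# - r) ^ suc m

  -- The second hypothesis has the form in which a Heyting field provides inverses: `d # 0#` inverts
  -- `d - 0#`.
  quotient : ∀ {x y d e} → y ≈ x ⊗ d → (d - 0#) ⊗ e ≈ 1# → x ≈ y ⊗ e
  quotient {x} {y} {d} {e} y≈xd de≈1 = begin
    x                    ≈⟨ *-identityʳ x ⟨
    x ⊗ 1#               ≈⟨ *-congˡ de≈1 ⟨
    x ⊗ ((d - 0#) ⊗ e)   ≈⟨ *-congˡ (*-congʳ (≈-trans (+-congˡ -0#≈0#) (+-identityʳ d))) ⟩
    x ⊗ (d ⊗ e)          ≈⟨ *-assoc x d e ⟨
    (x ⊗ d) ⊗ e          ≈⟨ *-congʳ y≈xd ⟨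
    y ⊗ e                ∎

closed-forms : ∀ {c ℓ₁ ℓ₂} (K : HeytingField c ℓ₁ ℓ₂) →
               ClosedForms K (λ n → free (n ∸ 1)) (λ n → blocked (n ∸ 1))
closed-forms K r r²≈2 2#0 2r#0 (suc m) _ =
    quotient (power-difference r r²≈2 m) (proj₂ (proj₂ (#⇒invertible 2r#0)))
  , quotient (power-sum r r²≈2 m) (proj₂ (proj₂ (#⇒invertible 2#0)))
  where
  open HeytingField K using (heytingCommutativeRing; #⇒invertible)
  open PellPowers (HeytingCommutativeRing.commutativeRing heytingCommutativeRing)

theorem1 : (c ℓ₁ ℓ₂ : Level) →
    Σ[ H ∈ (ℕ → ℕ) ] Σ[ P ∈ (ℕ → ℕ) ]
    (∀ n → 1 ≤ n → HasTilingCount (regionH n) (H n) × HasTilingCount (regionP n) (P n))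
    × (H 1 ≡ 1 × H 2 ≡ 3 × P 1 ≡ 1 × P 2 ≡ 2)
    × (∀ n → 2 ≤ n → H n ≡ H (n ∸ 1) + 2 * P (n ∸ 1) × P n ≡ H (n ∸ 1) + P (n ∸ 1))
    × (∀ n → 3 ≤ n → H n ≡ 2 * H (n ∸ 1) + H (n ∸ 2) × P n ≡ 2 * P (n ∸ 1) + P (n ∸ 2))
    × map P (1 ∷ 2 ∷ 3 ∷ 4 ∷ 5 ∷ 6 ∷ []) ≡ 1 ∷ 2 ∷ 5 ∷ 12 ∷ 29 ∷ 70 ∷ []
    × map H (1 ∷ 2 ∷ 3 ∷ 4 ∷ 5 ∷ 6 ∷ []) ≡ 1 ∷ 3 ∷ 7 ∷ 17 ∷ 41 ∷ 99 ∷ []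
    × (∀ n → 1 ≤ n → P n ≡ pell n)
    × ((K : HeytingField c ℓ₁ ℓ₂) → ClosedForms K H P)
theorem1 c ℓ₁ ℓ₂ =
    -- H_n has n - 1 positions. At `n = 0`, below the range of all the claims, truncated subtraction
    -- repeats the value at 1.
    (λ n → free (n ∸ 1))
  , (λ n → blocked (n ∸ 1))
  , (λ { (suc m) _ → count-H m , count-P m })
  , (refl , refl , refl , refl)
  , (λ { (suc (suc m)) _ → free-suc m , refl ; (suc zero) (s≤s ()) })
  , (λ { (suc (suc (suc m))) _ → free-pell m , blocked-pell m
       ; (suc (suc zero)) (s≤s (s≤s ())) ; (suc zero) (s≤s ()) })
  , refl
  , refl
  , (λ { (suc m) _ → blocked≡pell m })
  , closed-forms
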